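{- The derivation of an identified tableau is valid; that is: let $\mathbf{T}=(G,\mathcal{G},\mathcal{M},\mathcal{X},\simeq)$ be a valid matroid tableau and let $M_1,M_2\in\{G'\mid G'\text{ is a minor of }G\}\cup\mathcal{G}\cup\mathcal{M}\cup\mathcal{X}$ be such that $M_1$ is a deflate of $M_2$. Then the identified tableau $\mathbf{T}(M_1\simeq M_2)$ is a valid matroid tableau.
   Context: Matroids are pairs $M=(E,\mathcal{I})$ with $E$ a finite ground set. $M|X$ is the restriction of $M$ to $X\subseteq E$, $\mathcal{F}(M)$ is the family of flats of $M$, and $\mathrm{cl}_M$ is the closure operator. Deflate: for a matroid $M=(E,\mathcal{I})$ and $X\subseteq E$, the restriction $M|X$ is a deflate of $M$ if the elements of $E\setminus X$ can be ordered as $e_1,\ldots,e_m$ (pairwise distinct) such that for all $i\in\{1,\ldots,m\}$ the family $C_i=\{F\in\mathcal{F}(M|(X\cup\{e_1,\ldots,e_{i-1}\}))\mid e_i\in\mathrm{cl}_M(F)\}$ has precisely one $\subseteq$-minimal element. A digraph is a pair $D=(V,A)$ with $V$ finite and $A\subseteq V\times V$. A path in $D$ is a non-empty, non-repeating sequence of vertices $p_1p_2\ldots p_n$ with $(p_i,p_{i+1})\in A$ for $1\le i<n$. A routing from $X$ to $Y$ in $D$ is a family $R$ of paths in $D$ such that every $x\in X$ is the first vertex of some $p\in R$, every $p\in R$ ends in a vertex of $Y$, and any two distinct paths of $R$ are vertex-disjoint. For $E,T\subseteq V$, $\Gamma(D,T,E)$ is the matroid on $E$ whose independent sets are those $X\subseteq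 E$ for which there is a routing from $X$ to $T$ in $D$. A matroid $(E,\mathcal{I})$ is a gammoid if it equals $\Gamma(D,T,E)$ for some digraph $D=(V,A)$ with $E\subseteq V$ and some $T\subseteq V$; it is a strict gammoid if such a representation exists with $V=E$. A matroid tableau is a tuple $\mathbf{T}=(G,\mathcal{G},\mathcal{M},\mathcal{X},\simeq)$ where $G$ is a matroid (the goal), $\mathcal{G},\mathcal{M},\mathcal{X}$ are families of matroids, and $\simeq$ is an equivalence relation on $\{G'\mid G'\text{ is a minor of }G\}\cup\mathcal{G}\cup\mathcal{M}\cup\mathcal{X}$. $\mathbf{T}$ is valid if (i) all matroids in $\mathcal{G}$ are gammoids, (ii) no matroid in $\mathcal{M}$ is a strict gammoid, (iii) no matroid in $\mathcal{X}$ is a gammoid, and (iv) every equivalence class of $\simeq$ either consists only of gammoids or contains no gammoid. The identified tableau for $\mathbf{T}$ with respect to $M_1$ and $M_2$ is $\mathbf{T}(M_1\simeq M_2)=(G,\mathcal{G},\mathcal{M},\mathcal{X},\simeq')$, where $\simeq'$ is the smallest equivalence relation such that $M_1\simeq' M_2$ and such that $M'\simeq N'$ implies $M'\simeq' N'$. -}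

module Defs where

open import Level using (0ℓ) renaming (suc to lsuc)
open import Data.Fin.Base using (Fin; toℕ)
open import Data.List.Base
  using (List; []; _∷_; _++_; length; deduplicate; filter; lookup; take)
open import Data.List.Membership.Propositional using (_∈_; _∉_)
import Data.List.Membership.DecPropositional as DecMembership
open import Data.List.NonEmpty.Base using (List⁺; head; last; toList)
open import Data.List.Relation.Binary.BagAndSetEquality using (_∼[_]_; set)
open import Data.List.Relation.Binary.Disjoint.Propositional using (Disjoint)
open import Data.List.Relation.Binary.Subset.Propositional using (_⊆_)
open import Data.List.Relation.Unary.Linked using (Linked)
open import Data.List.Relation.Unary.Unique.Propositional using (Unique)
open import Data.Nat.Base using (ℕ; _≤_; _<_)
open import Data.Product.Base using (Σ; ∃; ∃-syntax; _×_; _,_; proj₁)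
open import Data.Sum.Base using (_⊎_)
open import Function.Bundles using (_⇔_)
open import Relation.Binary.Core using (Rel)
open import Relation.Binary.Definitions using (DecidableEquality; _Respects_)
open import Relation.Binary.PropositionalEquality.Core using (_≡_; _≢_)
open import Relation.Binary.Structures using (IsEquivalence)
import Relation.Binary.Construct.Closure.Equivalence as EqC
open import Relation.Binary.Construct.Closure.Equivalence using (EqClosure)
open import Relation.Binary.Construct.Closure.Symmetric using (fwd)
open import Relation.Binary.Construct.Closure.ReflexiveTransitive using (ε; _◅_)
open import Relation.Nullary.Negation using (¬_)
open import Relation.Unary using (Pred; Decidable; _≐_)

-- The universe from which all elements of ground sets and all vertices of
-- digraphs are drawn.  As in set theory, no finite set exhausts it, so a
-- digraph may have any finite number of vertices outside a given ground set.

record Universe : Set₁ where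
  field
    Element : Set
    _≟_     : DecidableEquality Element
    fresh   : (xs : List Element) → ∃[ x ] x ∉ xs

module Matroids (𝕌 : Universe) where

  open Universe 𝕌 public
  open DecMembership _≟_ using (_∉?_)

  -- Finite sets are lists; order and multiplicity carry no meaning, and
  -- equality of finite sets is _∼[ set ]_.

  FinSet : Set
  FinSet = List Element

  card : FinSet → ℕ
  card X = length (deduplicate _≟_ X)

  record SetSystem : Set₁ where
    constructor _,,_
    field
      ground : FinSet
      Indep  : Pred FinSet 0ℓ

  open SetSystem public

  infix 4 _≈ₛ_
  _≈ₛ_ : Rel SetSystem 0ℓ
  S ≈ₛ S′ = (ground S ∼[ set ] ground S′) × (Indep S ≐ Indep S′)

  -- `indep?` says that the independent sets form a family of subsets of a
  -- finite set in the classical sense.  `hereditary` also makes independence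
  -- invariant under equality of finite sets.

  record IsMatroid (S : SetSystem) : Set where
    field
      indep?     : Decidable (Indep S)
      ⊆-ground   : ∀ {X} → Indep S X → X ⊆ ground S
      empty      : Indep S []
      hereditary : ∀ {X Y} → X ⊆ Y → Indep S Y → Indep S X
      augment    : ∀ {X Y} → Indep S X → Indep S Y → card X < card Y →
                   ∃[ y ] y ∈ Y × y ∉ X × Indep S (y ∷ X)

  record Matroid : Set₁ where
    field
      system    : SetSystem
      isMatroid : IsMatroid system
    open IsMatroid isMatroid public

  open Matroid public using (system; isMatroid)

  infix 4 _≈_
  _≈_ : Rel Matroid 0ℓ
  M ≈ N = system M ≈ₛ system N

  infixl 6 _∣_ _/_

  _∣_ : SetSystem → FinSet → SetSystem
  S ∣ X = X ,, λ Y → Y ⊆ X × Indep S Y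

  IsBase : SetSystem → FinSet → FinSet → Set
  IsBase S Z B = B ⊆ Z × Indep S B × (∀ {z} → z ∈ Z → Indep S (z ∷ B) → z ∈ B)

  _/_ : SetSystem → FinSet → SetSystem
  S / Z = E∖Z ,, λ Y → Y ⊆ E∖Z × ∃[ B ] IsBase S Z B × Indep S (Y ++ B)
    where E∖Z = filter (_∉? Z) (ground S)

  IsMinor : Matroid → Matroid → Set
  IsMinor N M = ∃[ X ] ∃[ Z ] X ⊆ ground (system M) × Z ⊆ X ×
                (system N ≈ₛ system M ∣ X / Z)

  IsRank : SetSystem → FinSet → ℕ → Set
  IsRank S X r = (∃[ Y ] Y ⊆ X × Indep S Y × card Y ≡ r) ×
                 (∀ Y → Y ⊆ X → Indep S Y → card Y ≤ r)

  -- cl(X) = { x ∈ E | rk(X ∪ {x}) = rk(X) }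
  cl : SetSystem → FinSet → Pred Element 0ℓ
  cl S X x = x ∈ ground S × ∃[ r ] IsRank S X r × IsRank S (x ∷ X) r

  IsFlat : SetSystem → Pred FinSet 0ℓ
  IsFlat S F = F ⊆ ground S × (cl S F ≐ (_∈ F))

  IsMinimal : Pred FinSet 0ℓ → Pred FinSet 0ℓ
  IsMinimal 𝓒 F = 𝓒 F × (∀ G → 𝓒 G → G ⊆ F → F ⊆ G)

  HasUniqueMinimal : Pred FinSet 0ℓ → Set
  HasUniqueMinimal 𝓒 =
    ∃[ F ] IsMinimal 𝓒 F × (∀ G → IsMinimal 𝓒 G → G ∼[ set ] F)

  -- With the index i counted from 0, `lookup es i` is the element e_{i+1} and
  -- `take (toℕ i) es` is {e_1,…,e_i}.
  DeflatesTo : Matroid → FinSet → Set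
  DeflatesTo M X =
    ∃[ es ] Unique es ×
      (∀ x → x ∈ es ⇔ (x ∈ ground S × x ∉ X)) ×
      (∀ (i : Fin (length es)) → HasUniqueMinimal λ F →
         IsFlat (S ∣ (X ++ take (toℕ i) es)) F × cl S F (lookup es i))
    where S = system M

  IsDeflateOf : Matroid → Matroid → Set
  IsDeflateOf N M = ∃[ X ] X ⊆ ground (system M) ×
                    (system N ≈ₛ system M ∣ X) × DeflatesTo M X

  record Digraph : Set where
    field
      vertices : FinSet
      arcs     : List (Element × Element)
      arcs-⊆   : ∀ {u v} → (u , v) ∈ arcs → u ∈ vertices × v ∈ vertices

  open Digraph public

  IsPath : Digraph → Pred (List⁺ Element) 0ℓ
  IsPath D p = toList p ⊆ vertices D × Unique (toList p) ×
               Linked (λ u v → (u , v) ∈ arcs D) (toList p)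

  record IsRouting (D : Digraph) (X Y : FinSet) (R : List (List⁺ Element)) : Set where
    field
      paths    : ∀ {p} → p ∈ R → IsPath D p
      starts   : ∀ {x} → x ∈ X → ∃[ p ] p ∈ R × head p ≡ x
      ends     : ∀ {p} → p ∈ R → last p ∈ Y
      disjoint : ∀ {p q} → p ∈ R → q ∈ R → p ≢ q → Disjoint (toList p) (toList q)

  Γ : Digraph → FinSet → FinSet → SetSystem
  Γ D T E = E ,, λ X → X ⊆ E × ∃[ R ] IsRouting D X T R

  IsGammoid : Pred Matroid 0ℓ
  IsGammoid M = ∃[ D ] ∃[ T ] ∃[ E ] T ⊆ vertices D × E ⊆ vertices D ×
                (system M ≈ₛ Γ D T E)

  IsStrictGammoid : Pred Matroid 0ℓ
  IsStrictGammoid M = ∃[ D ] ∃[ T ] T ⊆ vertices D ×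
                      (system M ≈ₛ Γ D T (vertices D))

  -- { G′ | G′ is a minor of G } ∪ 𝓖 ∪ 𝓜 ∪ 𝓧
  Member : Matroid → (𝓖 𝓜 𝓧 : Pred Matroid (lsuc 0ℓ)) → Set₁
  Member G 𝓖 𝓜 𝓧 = Σ Matroid λ M → IsMinor M G ⊎ 𝓖 M ⊎ 𝓜 M ⊎ 𝓧 M

  -- Since equality of matroids is _≈_, families are closed under it and ≃ is
  -- reflexive with respect to it.
  record Tableau : Set₂ where
    field
      goal  : Matroid
      𝓖 𝓜 𝓧 : Pred Matroid (lsuc 0ℓ)
      𝓖-resp : 𝓖 Respects _≈_
      𝓜-resp : 𝓜 Respects _≈_
      𝓧-resp : 𝓧 Respects _≈_
      _≃_   : Rel (Member goal 𝓖 𝓜 𝓧) (lsuc 0ℓ)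
      ≃-isEquivalence : IsEquivalence _≃_
      ≃-reflexive : ∀ {M N} → proj₁ M ≈ proj₁ N → M ≃ N

  MemberOf : Tableau → Set₁
  MemberOf T = Member goal 𝓖 𝓜 𝓧
    where open Tableau T

  record IsValid (T : Tableau) : Set₁ where
    open Tableau T
    field
      𝓖-gammoids    : ∀ {M} → 𝓖 M → IsGammoid M
      𝓜-not-strict  : ∀ {M} → 𝓜 M → ¬ IsStrictGammoid M
      𝓧-no-gammoids : ∀ {M} → 𝓧 M → ¬ IsGammoid M
      classes       : ∀ M → (∀ N → M ≃ N → IsGammoid (proj₁ N)) ⊎
                            (∀ N → M ≃ N → ¬ IsGammoid (proj₁ N))

  data Identified (T : Tableau) (M₁ M₂ : MemberOf T) : Rel (MemberOf T) (lsuc 0ℓ) where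
    old : ∀ {M N} → Tableau._≃_ T M N → Identified T M₁ M₂ M N
    new : Identified T M₁ M₂ M₁ M₂

  identify : (T : Tableau) (M₁ M₂ : MemberOf T) → Tableau
  identify T M₁ M₂ = record
    { goal = goal ; 𝓖 = 𝓖 ; 𝓜 = 𝓜 ; 𝓧 = 𝓧
    ; 𝓖-resp = 𝓖-resp ; 𝓜-resp = 𝓜-resp ; 𝓧-resp = 𝓧-resp
    ; _≃_ = EqClosure (Identified T M₁ M₂)
    ; ≃-isEquivalence = EqC.isEquivalence (Identified T M₁ M₂)
    ; ≃-reflexive = λ M≈N → fwd (old (≃-reflexive M≈N)) ◅ ε
    }
    where open Tableau T

{-# OPTIONS --safe #-}
-- A deflate of M is a restriction of M, hence a gammoid when M is.  Conversely,
-- let e extend M|Y, where F₀ is the least flat of M|Y whose closure contains e.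
-- Then Z ∪ {e} is independent iff Z ∪ {f} is for some f ∈ F₀ ∖ Z.  If D
-- represents M|Y and e is not a vertex of D (rename it otherwise), then adding
-- the vertex e to D with an arc to every element of F₀ represents M|(Y ∪ {e}).
-- So ≃ and the new pair M₁ ≃ M₂ both respect being a gammoid, and hence so does
-- the equivalence relation they generate.
module Submission where

open import Data.Empty using (⊥)
open import Data.Fin.Base using (Fin; zero; suc; toℕ)
open import Data.List.Base
  using (List; []; _∷_; [_]; _++_; filter; initLast; _∷ʳ′_; length; lookup; map; take)
open import Data.List.Membership.Propositional using (_∈_; _∉_; find; lose)
open import Data.List.Membership.Propositional.Properties
  using (∈-++⁺ˡ; ∈-++⁺ʳ; ∈-++⁻; ∈-deduplicate⁻; ∈-deduplicate⁺; ∈-filter⁺; ∈-filter⁻; ∈-map⁺; ∈-map⁻)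
import Data.List.Membership.DecPropositional as DecMembership
open import Data.List.NonEmpty.Base as NE using (List⁺; head; last; toList; _∷⁺_)
open import Data.List.Properties using (filter-all; filter-notAll; ++-assoc; ++-identityʳ)
open import Data.List.Relation.Binary.BagAndSetEquality using (_∼[_]_; set)
import Data.List.Relation.Binary.Subset.DecPropositional as DecSubset
open import Data.List.Relation.Binary.Subset.Propositional using (_⊆_)
import Data.List.Relation.Unary.All as All
open import Data.List.Relation.Unary.All using ([]; _∷_)
open import Data.List.Relation.Unary.AllPairs using ([]; _∷_)
open import Data.List.Relation.Unary.Any using (any?; here; there)
open import Data.List.Relation.Unary.Linked as Linked using (Linked; [-]; _∷_)
import Data.List.Relation.Unary.Linked.Properties as Linked
open import Data.List.Relation.Unary.Unique.Propositional using (Unique)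
import Data.List.Relation.Unary.Unique.Propositional.Properties as Unique
import Data.List.Relation.Unary.Unique.DecPropositional.Properties as DecUnique
open import Data.Nat.Base using (zero; suc; _+_; _≤_; _<_; z≤n; s≤s)
open import Data.Nat.Properties
  using (≤-refl; ≤-reflexive; ≤-trans; ≮⇒≥; <⇒≱; +-suc; m≤m+n; _<?_)
open import Data.Product.Base using (∃-syntax; _×_; _,_; proj₁; proj₂) renaming (map to map×)
open import Data.Sum.Base using (inj₁; inj₂; [_,_]′)
import Data.Sum.Base as Sum
open import Function.Base using (_∘_; id)
open import Function.Bundles using (_⇔_; mk⇔; Equivalence)
open import Function.Properties.Equivalence using (⇔-isEquivalence)
open import Relation.Binary.PropositionalEquality
  using (_≡_; _≢_; refl; sym; trans; cong; subst)
import Relation.Binary.Construct.Closure.Equivalence as EqClosure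
open import Relation.Binary.Structures using (IsEquivalence)
open import Relation.Nullary.Decidable using (yes; no; _×-dec_; _→-dec_; ¬?; decidable-stable)
open import Relation.Nullary.Negation using (¬_; contradiction)
open import Relation.Unary using (Pred; Decidable)
open import Defs

-- Lists and their last entries.

last-∷ : ∀ {A : Set} (x y : A) ys → last (x NE.∷ y ∷ ys) ≡ last (y NE.∷ ys)
last-∷ x y ys with initLast ys
... | []       = refl
... | _ ∷ʳ′ _ = refl

last-map : ∀ {A B : Set} (f : A → B) x xs → last (NE.map f (x NE.∷ xs)) ≡ f (last (x NE.∷ xs))
last-map f x []       = refl
last-map f x (y ∷ ys) = trans (last-∷ (f x) (f y) (map f ys))
  (trans (last-map f y ys) (cong f (sym (last-∷ x y ys))))

∷-⊆ : ∀ {A : Set} {x : A} {xs ys} → x ∈ ys → xs ⊆ ys → x ∷ xs ⊆ ys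
∷-⊆ x∈ys xs⊆ys (here refl) = x∈ys
∷-⊆ x∈ys xs⊆ys (there z∈xs) = xs⊆ys z∈xs

module _ (𝕌 : Universe) where

  open Matroids 𝕌
  open DecMembership _≟_ using (_∈?_; _∉?_)
  open DecSubset _≟_ using (_⊆?_)

  -- Finite sets and cardinality.

  infixl 7 _∖_
  _∖_ : FinSet → Element → FinSet
  X ∖ e = filter (λ x → ¬? (e ≟ x)) X

  ∖-⊆ : ∀ {X} e → X ∖ e ⊆ X
  ∖-⊆ e = proj₁ ∘ ∈-filter⁻ (λ x → ¬? (e ≟ x))

  ∖-∉ : ∀ e X → e ∉ X ∖ e
  ∖-∉ e X e∈ = proj₂ (∈-filter⁻ (λ x → ¬? (e ≟ x)) {xs = X} e∈) refl

  ∖-⁺ : ∀ {e x X} → x ∈ X → e ≢ x → x ∈ X ∖ e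
  ∖-⁺ {e} = ∈-filter⁺ (λ x → ¬? (e ≟ x))

  ⊆-∷∖ : ∀ e X → X ⊆ e ∷ X ∖ e
  ⊆-∷∖ e X {x} x∈X with e ≟ x
  ... | yes refl = here refl
  ... | no  e≢x  = there (∖-⁺ x∈X e≢x)

  length-mono : ∀ {X Y} → Unique X → X ⊆ Y → length X ≤ length Y
  length-mono []                  _    = z≤n
  -- Deleting `x` shortens `Y` by at least one entry but keeps all of the tail `X`, in which `x`
  -- does not recur.
  length-mono {x ∷ X} {Y} (x∉X ∷ X!) x∷X⊆Y = ≤-trans
    (s≤s (length-mono X! λ z∈X → ∖-⁺ (x∷X⊆Y (there z∈X)) (All.lookup x∉X z∈X)))
    (filter-notAll (λ y → ¬? (x ≟ y)) Y (lose (x∷X⊆Y (here refl)) λ x≢x → x≢x refl))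

  card-mono : ∀ {X Y} → X ⊆ Y → card X ≤ card Y
  card-mono {X} X⊆Y = length-mono (DecUnique.deduplicate-! _≟_ X)
    (∈-deduplicate⁺ _≟_ ∘ X⊆Y ∘ ∈-deduplicate⁻ _≟_ X)

  card-∷ : ∀ {x X} → x ∉ X → card (x ∷ X) ≡ suc (card X)
  card-∷ {x} {X} x∉X = cong (suc ∘ length) (filter-all (λ y → ¬? (x ≟ y))
    (All.tabulate λ { y∈ refl → x∉X (∈-deduplicate⁻ _≟_ X y∈) }))

  card-strict : ∀ {X Y} → X ⊆ Y → ¬ (Y ⊆ X) → card X < card Y
  card-strict {X} {Y} X⊆Y Y⊈X with any? (_∉? X) Y
  ... | yes some with y , y∈Y , y∉X ← find some =
        subst (_≤ card Y) (card-∷ y∉X) (card-mono (∷-⊆ y∈Y X⊆Y))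
  ... | no none = contradiction
        (λ {y} y∈Y → decidable-stable (y ∈? X) λ y∉X → none (lose y∈Y y∉X)) Y⊈X

  -- Matroids

  -- Packaged as a matroid so that the closure lemmas below also apply inside `M ∣ Y`, where the
  -- flats live.
  restrict : Matroid → FinSet → Matroid
  restrict M X = record
    { system    = system M ∣ X
    ; isMatroid = record
      { indep?     = λ Y → (Y ⊆? X) ×-dec M.indep? Y
      ; ⊆-ground   = proj₁
      ; empty      = (λ ()) , M.empty
      ; hereditary = λ Y⊆Z (Z⊆X , iZ) → (Z⊆X ∘ Y⊆Z) , M.hereditary Y⊆Z iZ
      ; augment    = λ (Y⊆X , iY) (Z⊆X , iZ) Y<Z →
          let y , y∈Z , y∉Y , iyY = M.augment iY iZ Y<Z
          in y , y∈Z , y∉Y , ∷-⊆ (Z⊆X y∈Z) Y⊆X , iyY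
      }
    }
    where module M = Matroid M

  module MatroidTheory (M : Matroid) where

    open Matroid M using (indep?; ⊆-ground; hereditary; augment)

    private S = system M

    -- For independent Z this is membership in the closure of Z.
    Span : FinSet → Pred Element _
    Span Z x = Indep S (x ∷ Z) → x ∈ Z

    span? : ∀ Z → Decidable (Span Z)
    span? Z x = indep? (x ∷ Z) →-dec (x ∈? Z)

    -- Otherwise `augment` would enlarge `Z` by an element of `W` outside `Z`, which `Span` forbids.
    span-card : ∀ {Z W} → Indep S Z → Indep S W → (∀ {w} → w ∈ W → Span Z w) → card W ≤ card Z
    span-card iZ iW W⊆span = ≮⇒≥ λ Z<W →
      let w , w∈W , w∉Z , iwZ = augment iZ iW Z<W in w∉Z (W⊆span w∈W iwZ)

    span-rank : ∀ {Z F} → Indep S Z → Z ⊆ F → (∀ {f} → f ∈ F → Span Z f) → IsRank S F (card Z)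
    span-rank {Z} iZ Z⊆F F⊆span =
      (Z , Z⊆F , iZ , refl) , λ W W⊆F iW → span-card iZ iW (F⊆span ∘ W⊆F)

    -- `Z` attains the rank of both `F` and `x ∷ F`, so both ranks are `card Z`.
    span⇒cl : ∀ {Z F x} → Indep S Z → Z ⊆ F → (∀ {f} → f ∈ F → Span Z f) →
              x ∈ ground S → Span Z x → cl S F x
    span⇒cl iZ Z⊆F F⊆span x∈E x∈span = x∈E , _ , span-rank iZ Z⊆F F⊆span ,
      span-rank iZ (there ∘ Z⊆F) λ { (here refl) → x∈span ; (there f∈F) → F⊆span f∈F }

    extend : ∀ {Y W} → Indep S Y → Indep S W →
             ∃[ Y′ ] Y ⊆ Y′ × Y′ ⊆ W ++ Y × Indep S Y′ × card W ≤ card Y′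
    extend {Y} {W} iY iW = go (card W) iY (m≤m+n _ _)
      where
      -- `n` bounds how many elements `Y` still lacks to reach the size of `W`.
      go : ∀ n {Y} → Indep S Y → card W ≤ n + card Y →
           ∃[ Y′ ] Y ⊆ Y′ × Y′ ⊆ W ++ Y × Indep S Y′ × card W ≤ card Y′
      go zero    {Y} iY W≤Y = Y , id , ∈-++⁺ʳ W , iY , W≤Y
      go (suc n) {Y} iY W≤ with card Y <? card W
      ... | no  Y≮W = Y , id , ∈-++⁺ʳ W , iY , ≮⇒≥ Y≮W
      ... | yes Y<W =
        let y , y∈W , y∉Y , iyY = augment iY iW Y<W
            Y′ , yY⊆Y′ , Y′⊆ , iY′ , W≤Y′ = go n iyY (≤-trans W≤ (≤-reflexive
              (trans (sym (+-suc n (card Y))) (cong (n +_) (sym (card-∷ y∉Y))))))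
        in Y′ , yY⊆Y′ ∘ there
         , [ ∈-++⁺ˡ , ∷-⊆ (∈-++⁺ˡ y∈W) (∈-++⁺ʳ W) ]′ ∘ ∈-++⁻ W ∘ Y′⊆
         , iY′ , W≤Y′

    -- If `F` lies in the closure of `Z`, so does the closure of `F`. Let `Y` attain the rank of
    -- `F`, suppose `x ∷ Z` is independent with `x` outside `Z`, and extend `Y` by elements of
    -- `x ∷ Z` to `Y′` of size at least `card (x ∷ Z)`. If `x` is in `Y`, it is in `F`, hence
    -- spanned by `Z`. If `x` is only in `Y′`, then `x ∷ Y` exceeds the rank of `x ∷ F`. If `x` is
    -- not in `Y′`, then `Z` spans `Y′`, which is too large.
    cl⇒span : ∀ {Z F x} → Indep S Z → (∀ {f} → f ∈ F → Span Z f) → cl S F x → Span Z x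
    cl⇒span {Z} {F} {x} iZ F⊆span (_ , _ , ((Y , Y⊆F , iY , refl) , _) , (_ , bound)) ixZ
      with x ∈? Z
    ... | yes x∈Z = x∈Z
    ... | no  x∉Z with extend iY ixZ
    ...   | Y′ , Y⊆Y′ , Y′⊆ , iY′ , xZ≤Y′ with x ∈? Y′ | x ∈? Y
    ...     | _        | yes x∈Y = F⊆span (Y⊆F x∈Y) ixZ
    ...     | yes x∈Y′ | no x∉Y = contradiction
              (bound (x ∷ Y) (∷-⊆ (here refl) (there ∘ Y⊆F)) (hereditary (∷-⊆ x∈Y′ Y⊆Y′) iY′))
              (<⇒≱ (≤-reflexive (sym (card-∷ x∉Y))))
    ...     | no x∉Y′  | no _ = contradiction
              (span-card iZ iY′ λ y∈Y′ → [ zZ y∈Y′ , F⊆span ∘ Y⊆F ]′ (∈-++⁻ (x ∷ Z) (Y′⊆ y∈Y′)))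
              (<⇒≱ (subst (_≤ card Y′) (card-∷ x∉Z) xZ≤Y′))
      where
      zZ : ∀ {y} → y ∈ Y′ → y ∈ x ∷ Z → Span Z y
      zZ y∈Y′ (here refl) = contradiction y∈Y′ x∉Y′
      zZ _    (there y∈Z) _ = y∈Z

  -- Extending a restriction by one element.

  module SingleExtension (M : Matroid) {Y : FinSet} {e : Element}
    (e∈E : e ∈ ground (system M)) where

    open Matroid M using (indep?; hereditary)
    open MatroidTheory M

    private
      S = system M
      module Restricted = MatroidTheory (restrict M Y)

    FlatSpanning : Pred FinSet _
    FlatSpanning F = IsFlat (S ∣ Y) F × cl S F e

    -- By infinite descent on the cardinality of F.
    least-flat : ∀ {F₀} → (∀ G → IsMinimal FlatSpanning G → G ∼[ set ] F₀) →
                 ∀ {F} → FlatSpanning F → F₀ ⊆ F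
    least-flat {F₀} unique {F} FSF = decidable-⊆ (¬¬⊆ (card F) ≤-refl FSF)
      where
      decidable-⊆ : ∀ {X Y} → ¬ ¬ (X ⊆ Y) → X ⊆ Y
      decidable-⊆ {X} {Y} = decidable-stable (X ⊆? Y)

      -- If `F₀ ⊆ F` failed, `F` would be minimal: a strictly smaller `G` would contain `F₀` by
      -- induction, and then so would `F`. Uniqueness then identifies `F` with `F₀`. The argument is
      -- classical, and decidability of inclusion removes the double negation.
      ¬¬⊆ : ∀ n {F} → card F ≤ n → FlatSpanning F → ¬ ¬ (F₀ ⊆ F)
      minimal : ∀ n {F} → card F ≤ n → ¬ (F₀ ⊆ F) →
                ∀ G → FlatSpanning G → G ⊆ F → F ⊆ G

      ¬¬⊆ n {F} F≤n FSF F₀⊈F =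
        F₀⊈F (Equivalence.from (unique F (FSF , minimal n F≤n F₀⊈F)))

      minimal n {F} F≤n F₀⊈F G FSG G⊆F = decidable-⊆ λ F⊈G →
        descend n (≤-trans (card-strict G⊆F F⊈G) F≤n) λ F₀⊆G → F₀⊈F (G⊆F ∘ F₀⊆G)
        where
        descend : ∀ n → card G < n → ¬ ¬ (F₀ ⊆ G)
        descend (suc n) (s≤s G≤n) = ¬¬⊆ n G≤n FSG

    -- For independent `Z ⊆ Y` this is the closure of `Z` in `M ∣ Y`, in a form that can be filtered
    -- out of `Y`.
    span-flat : FinSet → FinSet
    span-flat Z = filter (span? Z) Y

    -- `Z` is a base of `span-flat Z`, so closures of the latter reduce to `Span Z`: inside `M ∣ Y`
    -- for flatness, inside `M` for `e`.
    span-flat-spanning : ∀ {Z} → Z ⊆ Y → Indep S Z → Span Z e → FlatSpanning (span-flat Z)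
    span-flat-spanning {Z} Z⊆Y iZ e∈span =
      ( F⊆Y
      , (λ c → ∈-filter⁺ (span? Z) (proj₁ c)
          λ ixZ → Restricted.cl⇒span (Z⊆Y , iZ) (λ f∈F → F⊆span f∈F ∘ proj₂) c
                    (∷-⊆ (proj₁ c) Z⊆Y , ixZ))
      , λ x∈F → Restricted.span⇒cl (Z⊆Y , iZ) Z⊆F (λ f∈F → F⊆span f∈F ∘ proj₂)
                  (F⊆Y x∈F) (F⊆span x∈F ∘ proj₂) )
      , span⇒cl iZ Z⊆F F⊆span e∈E e∈span
      where
      F⊆Y : span-flat Z ⊆ Y
      F⊆Y = proj₁ ∘ ∈-filter⁻ (span? Z)
      F⊆span : ∀ {f} → f ∈ span-flat Z → Span Z f
      F⊆span f∈F = proj₂ (∈-filter⁻ (span? Z) {xs = Y} f∈F)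
      Z⊆F : Z ⊆ span-flat Z
      Z⊆F z∈Z = ∈-filter⁺ (span? Z) (Z⊆Y z∈Z) λ _ → z∈Z

    -- This makes `e` a principal extension of `M ∣ Y` by the flat `F`. If no `f` in `F` extends
    -- `Z`, then `Z` spans `F` and hence `e`, so independence of `e ∷ Z` would put `e` into `Z ⊆ Y`.
    -- Conversely, if `e ∷ Z` is dependent, the closure of `Z` in `M ∣ Y` is a flat spanning `e`, so
    -- it contains the least one, `F`, and no `f` in `F` extends `Z`.
    principal : e ∉ Y → HasUniqueMinimal FlatSpanning →
                ∃[ F ] F ⊆ Y × (∀ {Z} → Z ⊆ Y →
                  Indep S (e ∷ Z) ⇔ (∃[ f ] f ∈ F × f ∉ Z × Indep S (f ∷ Z)))
    principal e∉Y (F , (((F⊆Y , _) , e∈clF) , _) , unique) =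
      F , F⊆Y , λ Z⊆Y → mk⇔ (to Z⊆Y) (from Z⊆Y)
      where
      to : ∀ {Z} → Z ⊆ Y → Indep S (e ∷ Z) → ∃[ f ] f ∈ F × f ∉ Z × Indep S (f ∷ Z)
      to {Z} Z⊆Y ieZ with any? (λ f → (f ∉? Z) ×-dec indep? (f ∷ Z)) F
      ... | yes some = find some
      ... | no  none = contradiction (Z⊆Y e∈Z) e∉Y
        where
        e∈Z : e ∈ Z
        e∈Z = cl⇒span (hereditary there ieZ)
          (λ {f} f∈F ifZ → decidable-stable (f ∈? Z) λ f∉Z → none (lose f∈F (f∉Z , ifZ)))
          e∈clF ieZ

      from : ∀ {Z} → Z ⊆ Y → ∃[ f ] f ∈ F × f ∉ Z × Indep S (f ∷ Z) → Indep S (e ∷ Z)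
      from {Z} Z⊆Y (f , f∈F , f∉Z , ifZ) = decidable-stable (indep? (e ∷ Z)) λ ¬ieZ →
        f∉Z (proj₂ (∈-filter⁻ (span? Z) {xs = Y} (least-flat unique
          (span-flat-spanning Z⊆Y (hereditary there ifZ) (λ ieZ → contradiction ieZ ¬ieZ)) f∈F)) ifZ)

  -- Gammoids

  -- Stated for set systems so that it applies directly to `system M ∣ Y`; at `system M` it unfolds
  -- to `IsGammoid M`.
  IsGammoidSystem : Pred SetSystem _
  IsGammoidSystem S = ∃[ D ] ∃[ T ] ∃[ E ] T ⊆ vertices D × E ⊆ vertices D × (S ≈ₛ Γ D T E)

  -- The same `D` and `T` serve; only the ground set shrinks. With `X` the whole ground set, this is
  -- transport along equality of set systems.
  ≈ₛ-restrict-gammoid : ∀ {S S′ X} → X ⊆ ground S → S′ ≈ₛ S ∣ X →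
                        IsGammoidSystem S → IsGammoidSystem S′
  ≈ₛ-restrict-gammoid {X = X} X⊆S (S′∼X , S′⇒ , ⇒S′) (D , T , E , T⊆V , E⊆V , S∼E , S⇒ , ⇒S) =
    D , T , X , T⊆V , E⊆V ∘ X⊆E , S′∼X
    , (λ i → let W⊆X , iS = S′⇒ i in W⊆X , proj₂ (S⇒ iS))
    , λ (W⊆X , routed) → ⇒S′ (W⊆X , ⇒S (X⊆E ∘ W⊆X , routed))
    where
    X⊆E : X ⊆ E
    X⊆E = Equivalence.to S∼E ∘ X⊆S

  -- Renaming the vertices of a digraph.

  -- Injectivity keeps paths non-repeating and distinct paths disjoint. As `D′` is arbitrary, an
  -- involution can be applied both to enter and to leave a renamed digraph.
  map-routing : ∀ {D D′ T T′ X X′ R} (σ : Element → Element) → (∀ {x y} → σ x ≡ σ y → x ≡ y) →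
                (∀ {v} → v ∈ vertices D → σ v ∈ vertices D′) →
                (∀ {u v} → (u , v) ∈ arcs D → (σ u , σ v) ∈ arcs D′) →
                (∀ {t} → t ∈ T → σ t ∈ T′) →
                (∀ {x′} → x′ ∈ X′ → ∃[ x ] x ∈ X × σ x ≡ x′) →
                IsRouting D X T R → IsRouting D′ X′ T′ (map (NE.map σ) R)
  map-routing {D′ = D′} {T′ = T′} σ σ-injective V→ A→ T→ X′→ routing = record
    { paths    = λ p′∈ → case-path (∈-map⁻ (NE.map σ) p′∈)
    ; starts   = λ x′∈X′ → let x , x∈X , σx≡x′ = X′→ x′∈X′
                               p , p∈R , hp≡x = R.starts x∈X
                           in NE.map σ p , ∈-map⁺ (NE.map σ) p∈R , trans (cong σ hp≡x) σx≡x′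
    ; ends     = λ p′∈ →
        let p , p∈R , p′≡ = ∈-map⁻ (NE.map σ) p′∈
            last≡ = trans (cong last p′≡) (last-map σ (head p) (NE.tail p))
        in subst (_∈ T′) (sym last≡) (T→ (R.ends p∈R))
    ; disjoint = λ p′∈ q′∈ → disjoint′ (∈-map⁻ (NE.map σ) p′∈) (∈-map⁻ (NE.map σ) q′∈)
    }
    where
    module R = IsRouting routing

    case-path : ∀ {p′} → ∃[ p ] p ∈ _ × p′ ≡ NE.map σ p → IsPath D′ p′
    case-path (p , p∈R , refl) =
      let p⊆V , p! , linked = R.paths p∈R in
      (λ v∈ → let u , u∈p , v≡ = ∈-map⁻ σ v∈ in subst (_∈ vertices D′) (sym v≡) (V→ (p⊆V u∈p)))
      , Unique.map⁺ σ-injective p! , Linked.map⁺ (Linked.map A→ linked)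

    disjoint′ : ∀ {p′ q′} → ∃[ p ] p ∈ _ × p′ ≡ NE.map σ p → ∃[ q ] q ∈ _ × q′ ≡ NE.map σ q →
                p′ ≢ q′ → ∀ {v} → ¬ (v ∈ toList p′ × v ∈ toList q′)
    disjoint′ (p , p∈R , refl) (q , q∈R , refl) p′≢q′ (v∈p′ , v∈q′) =
      let u , u∈p , v≡σu = ∈-map⁻ σ v∈p′
          w , w∈q , v≡σw = ∈-map⁻ σ v∈q′
          u≡w = σ-injective (trans (sym v≡σu) v≡σw)
      in R.disjoint p∈R q∈R (p′≢q′ ∘ cong (NE.map σ)) (u∈p , subst (_∈ toList q) (sym u≡w) w∈q)

  rename : (Element → Element) → Digraph → Digraph
  rename σ D = record
    { vertices = map σ (vertices D)
    ; arcs     = map (map× σ σ) (arcs D)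
    ; arcs-⊆   = λ a∈ → ends (∈-map⁻ (map× σ σ) a∈)
    }
    where
    ends : ∀ {u v} → ∃[ a ] a ∈ arcs D × (u , v) ≡ map× σ σ a →
           u ∈ map σ (vertices D) × v ∈ map σ (vertices D)
    ends (_ , a∈ , refl) = map× (∈-map⁺ σ) (∈-map⁺ σ) (arcs-⊆ D a∈)

  swap : Element → Element → Element → Element
  swap a b x with x ≟ a | x ≟ b
  ... | yes _ | _     = b
  ... | no _  | yes _ = a
  ... | no _  | no _  = x

  swap-fix : ∀ {a b x} → x ≢ a → x ≢ b → swap a b x ≡ x
  swap-fix {a} {b} {x} x≢a x≢b with x ≟ a | x ≟ b
  ... | yes x≡a | _       = contradiction x≡a x≢a
  ... | no _    | yes x≡b = contradiction x≡b x≢b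
  ... | no _    | no _    = refl

  swap-left : ∀ a b → swap a b a ≡ b
  swap-left a b with a ≟ a
  ... | yes _  = refl
  ... | no a≢a = contradiction refl a≢a

  swap-right : ∀ a b → swap a b b ≡ a
  swap-right a b with b ≟ a | b ≟ b
  ... | yes b≡a | _      = b≡a
  ... | no _    | yes _  = refl
  ... | no _    | no b≢b = contradiction refl b≢b

  swap-involutive : ∀ a b x → swap a b (swap a b x) ≡ x
  swap-involutive a b x with x ≟ a | x ≟ b
  ... | yes refl | _        = swap-right a b
  ... | no _     | yes refl = swap-left a b
  ... | no x≢a   | no x≢b   = swap-fix x≢a x≢b

  -- Transpose `e` with a vertex `v` outside `D`. Neither lies in `E`, so the ground set is fixed
  -- pointwise and the same sets are routed.
  avoid-vertex : ∀ {S} e → e ∉ ground S → IsGammoidSystem S →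
                 ∃[ D ] ∃[ T ] ∃[ E ] T ⊆ vertices D × E ⊆ vertices D × e ∉ vertices D × (S ≈ₛ Γ D T E)
  avoid-vertex e e∉S (D , T , E , T⊆V , E⊆V , S∼E , S⇒ , ⇒S) =
    rename σ D , map σ T , E
    , (λ t∈ → let t , t∈T , eq = ∈-map⁻ σ t∈ in subst (_∈ _) (sym eq) (∈-map⁺ σ (T⊆V t∈T)))
    , (λ x∈E → subst (_∈ _) (σ-fix x∈E) (∈-map⁺ σ (E⊆V x∈E)))
    , (λ e∈ → let x , x∈V , e≡σx = ∈-map⁻ σ e∈
                  x≡v = trans (sym (σσ x)) (trans (cong σ (sym e≡σx)) (swap-left e v))
              in v∉V (subst (_∈ vertices D) x≡v x∈V))
    , S∼E
    , (λ i → let W⊆E , R , routing = S⇒ i in W⊆E , _ ,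
         map-routing {D = D} {D′ = rename σ D} σ σ-injective (∈-map⁺ σ) (∈-map⁺ (map× σ σ)) (∈-map⁺ σ)
           (λ {x} x∈W → x , x∈W , σ-fix (W⊆E x∈W)) routing)
    , λ (W⊆E , R , routing) → ⇒S (W⊆E , _ ,
         map-routing {D = rename σ D} {D′ = D} σ σ-injective unmap
           (λ a∈ → unmap-arc (∈-map⁻ (map× σ σ) a∈)) unmap
           (λ {x} x∈W → x , x∈W , σ-fix (W⊆E x∈W)) routing)
    where
    v = proj₁ (fresh (vertices D))
    v∉V = proj₂ (fresh (vertices D))
    σ = swap e v
    σσ = swap-involutive e v

    σ-injective : ∀ {x y} → σ x ≡ σ y → x ≡ y
    σ-injective eq = trans (sym (σσ _)) (trans (cong σ eq) (σσ _))

    σ-fix : ∀ {x} → x ∈ E → σ x ≡ x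
    σ-fix x∈E = swap-fix (λ { refl → e∉S (Equivalence.from S∼E x∈E) }) λ { refl → v∉V (E⊆V x∈E) }

    unmap : ∀ {x X} → x ∈ map σ X → σ x ∈ X
    unmap {X = X} x∈ with x , x∈X , refl ← ∈-map⁻ σ x∈ = subst (_∈ X) (sym (σσ x)) x∈X

    unmap-arc : ∀ {a b} → ∃[ c ] c ∈ arcs D × (a , b) ≡ map× σ σ c → (σ a , σ b) ∈ arcs D
    unmap-arc ((x , y) , c∈ , refl) rewrite σσ x | σσ y = c∈

  -- Rerouting, and adding a source to a digraph.

  notFrom : Element → List (List⁺ Element) → List (List⁺ Element)
  notFrom x = filter (λ p → ¬? (head p ≟ x))

  ∈-notFrom⁻ : ∀ {x R p} → p ∈ notFrom x R → p ∈ R × head p ≢ x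
  ∈-notFrom⁻ {x} {R} = ∈-filter⁻ (λ p → ¬? (head p ≟ x)) {xs = R}

  -- Applied with `p′` equal to `p` with a first vertex added or removed. A vertex shared by `p′`
  -- and a remaining path would also lie on `p`, which that path avoids.
  replace-routing : ∀ {D D′ T X Y R x p p′} → IsRouting D X T R → p ∈ R → head p ≡ x →
                    IsPath D′ p′ → last p′ ∈ T →
                    (∀ {q} → q ∈ R → head q ≢ x → IsPath D′ q) →
                    (∀ {q v} → q ∈ R → head q ≢ x → v ∈ toList q → v ∈ toList p′ → v ∈ toList p) →
                    (∀ {y} → y ∈ Y → y ≢ head p′ → y ∈ X × y ≢ x) →
                    IsRouting D′ Y T (p′ ∷ notFrom x R)
  replace-routing {R = R} {x} {p} {p′} routing p∈R hp≡x path′ end′ others meets Y→ = record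
    { paths    = λ { (here refl) → path′
                   ; (there q∈) → let q∈R , h≢x = ∈-notFrom⁻ q∈ in others q∈R h≢x }
    ; starts   = starts′
    ; ends     = λ { (here refl) → end′ ; (there q∈) → R.ends (proj₁ (∈-notFrom⁻ q∈)) }
    ; disjoint = λ
        { (here refl) (here refl) p≢p _ → p≢p refl
        ; (here refl) (there q∈) _ (v∈p′ , v∈q) → clash q∈ v∈q v∈p′
        ; (there q∈) (here refl) _ (v∈q , v∈p′) → clash q∈ v∈q v∈p′
        ; (there q∈) (there r∈) → R.disjoint (proj₁ (∈-notFrom⁻ q∈)) (proj₁ (∈-notFrom⁻ r∈))
        }
    }
    where
    module R = IsRouting routing

    clash : ∀ {q v} → q ∈ notFrom x R → v ∈ toList q → v ∈ toList p′ → ⊥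
    clash q∈ v∈q v∈p′ = let q∈R , h≢x = ∈-notFrom⁻ q∈ in
      R.disjoint p∈R q∈R (λ { refl → h≢x hp≡x }) (meets q∈R h≢x v∈q v∈p′ , v∈q)

    starts′ : ∀ {y} → y ∈ _ → ∃[ q ] q ∈ p′ ∷ notFrom x R × head q ≡ y
    starts′ {y} y∈Y with y ≟ head p′
    ... | yes y≡h = p′ , here refl , sym y≡h
    ... | no  y≢h = let y∈X , y≢x = Y→ y∈Y y≢h
                        q , q∈R , hq≡y = R.starts y∈X
                    in q , there (∈-filter⁺ (λ q → ¬? (head q ≟ x)) q∈R
                                    λ hq≡x → y≢x (trans (sym hq≡y) hq≡x)) , hq≡y

  module AddSource (D : Digraph) {e : Element} (e∉V : e ∉ vertices D)
    {F : FinSet} (F⊆V : F ⊆ vertices D) where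

    addSource : Digraph
    addSource = record
      { vertices = e ∷ vertices D
      ; arcs     = map (e ,_) F ++ arcs D
      ; arcs-⊆   = λ a∈ → [ (λ a∈₁ → new-ends (∈-map⁻ (e ,_) a∈₁)) , map× there there ∘ arcs-⊆ D ]′
                            (∈-++⁻ (map (e ,_) F) a∈)
      }
      where
      new-ends : ∀ {u v} → ∃[ f ] f ∈ F × (u , v) ≡ (e , f) → u ∈ e ∷ vertices D × v ∈ e ∷ vertices D
      new-ends (f , f∈F , refl) = here refl , there (F⊆V f∈F)

    arc-from : ∀ {v} → (e , v) ∈ arcs addSource → v ∈ F
    arc-from {v} a∈ with ∈-++⁻ (map (e ,_) F) a∈
    ... | inj₁ a∈₁ with _ , f∈F , refl ← ∈-map⁻ (e ,_) a∈₁ = f∈F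
    ... | inj₂ a∈₂ = contradiction (proj₁ (arcs-⊆ D a∈₂)) e∉V

    old-arc : ∀ {u v} → u ≢ e → (u , v) ∈ arcs addSource → (u , v) ∈ arcs D
    old-arc u≢e a∈ with ∈-++⁻ (map (e ,_) F) a∈
    ... | inj₁ a∈₁ with _ , _ , refl ← ∈-map⁻ (e ,_) a∈₁ = contradiction refl u≢e
    ... | inj₂ a∈₂ = a∈₂

    -- No arc enters `e`, so a path can visit `e` only as its first vertex.
    old-linked : ∀ {u p} → u ≢ e → Linked (λ u v → (u , v) ∈ arcs addSource) (u ∷ p) →
                 p ⊆ vertices D × Linked (λ u v → (u , v) ∈ arcs D) (u ∷ p)
    old-linked _   [-]      = (λ ()) , [-]
    old-linked u≢e (a ∷ as) =
      let a′ = old-arc u≢e a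
          v∈V = proj₂ (arcs-⊆ D a′)
          p⊆V , as′ = old-linked (λ { refl → e∉V v∈V }) as
      in ∷-⊆ v∈V p⊆V , a′ ∷ as′

    old-path : ∀ {p} → head p ≢ e → IsPath addSource p → IsPath D p
    old-path {u NE.∷ p} u≢e (p⊆V′ , p! , linked) with p⊆V′ (here refl)
    ... | here u≡e  = contradiction u≡e u≢e
    ... | there u∈V = let p⊆V , linked′ = old-linked u≢e linked in ∷-⊆ u∈V p⊆V , p! , linked′

    new-path : ∀ {p} → IsPath D p → IsPath addSource p
    new-path (p⊆V , p! , linked) = there ∘ p⊆V , p! , Linked.map (∈-++⁺ʳ (map (e ,_) F)) linked

    lift-routing : ∀ {W T R} → IsRouting D W T R → IsRouting addSource W T R
    lift-routing routing = record
      { paths = new-path ∘ R.paths ; starts = R.starts ; ends = R.ends ; disjoint = R.disjoint }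
      where module R = IsRouting routing

    -- A routing may hold paths starting outside `W`, so one from `e` can occur and is discarded.
    drop-routing : ∀ {W T R} → e ∉ W → IsRouting addSource W T R → IsRouting D W T (notFrom e R)
    drop-routing {W} {R = R} e∉W routing = record
      { paths    = λ p∈ → let p∈R , h≢e = ∈-notFrom⁻ p∈ in old-path h≢e (R.paths p∈R)
      ; starts   = λ {x} x∈W → let p , p∈R , h≡x = R.starts x∈W in
                   p , ∈-filter⁺ (λ p → ¬? (head p ≟ e)) p∈R
                         (λ h≡e → e∉W (subst (_∈ W) (trans (sym h≡x) h≡e) x∈W)) , h≡x
      ; ends     = R.ends ∘ proj₁ ∘ ∈-notFrom⁻
      ; disjoint = λ p∈ q∈ → R.disjoint (proj₁ (∈-notFrom⁻ p∈)) (proj₁ (∈-notFrom⁻ q∈))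
      }
      where module R = IsRouting routing

    -- The path from `f` is not claimed by any other element of `W`, so it can be prolonged
    -- backwards to `e`, a vertex on no path of `D`.
    route-source : ∀ {W T f R} → f ∈ F → f ∉ W ∖ e → IsRouting D (f ∷ W ∖ e) T R →
                   ∃[ R′ ] IsRouting addSource W T R′
    route-source {W} {T} {f} f∈F f∉W routing with IsRouting.starts routing (here refl)
    ... | p@(_ NE.∷ ps) , p∈R , refl =
      let p⊆V , p! , linked = R.paths p∈R in
      _ , replace-routing {p′ = e ∷⁺ p} routing p∈R refl
            ( ∷-⊆ (here refl) (there ∘ p⊆V)
            , All.tabulate (λ { v∈p refl → e∉V (p⊆V v∈p) }) ∷ p!
            , ∈-++⁺ˡ (∈-map⁺ (e ,_) f∈F) ∷ Linked.map (∈-++⁺ʳ (map (e ,_) F)) linked )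
            (subst (_∈ T) (sym (last-∷ e (head p) ps)) (R.ends p∈R))
            (λ q∈R _ → new-path (R.paths q∈R))
            (λ { q∈R _ v∈q (here refl) → contradiction (proj₁ (R.paths q∈R) v∈q) e∉V
               ; _ _ _ (there v∈p) → v∈p })
            λ y∈W y≢e → let y∈ = ∖-⁺ y∈W (y≢e ∘ sym) in
              there y∈ , λ { refl → f∉W y∈ }
      where module R = IsRouting routing

    unroute-source : ∀ {W T R} → T ⊆ vertices D → e ∈ W → IsRouting addSource W T R →
                     ∃[ f ] f ∈ F × f ∉ W ∖ e × ∃[ R′ ] IsRouting D (f ∷ W ∖ e) T R′
    unroute-source {W} {T} T⊆V e∈W routing with IsRouting.starts routing e∈W
    -- Targets are vertices of `D`, so the path from `e` cannot stop there; its second vertex is the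
    -- desired `f`.
    ... | e NE.∷ [] , p∈R , refl = contradiction (T⊆V (IsRouting.ends routing p∈R)) e∉V
    ... | p@(e NE.∷ f ∷ ps) , p∈R , refl with IsRouting.paths routing p∈R
    ...   | p⊆V , _ ∷ p! , a ∷ linked =
      f , f∈F , f∉W , _ , replace-routing {p′ = f NE.∷ ps} routing p∈R refl
        (old-path f≢e (p⊆V ∘ there , p! , linked))
        (subst (_∈ T) (last-∷ e f ps) (R.ends p∈R))
        (λ q∈R h≢e → old-path h≢e (R.paths q∈R))
        (λ _ _ _ → there)
        λ { (here refl) y≢f → contradiction refl y≢f
          ; (there y∈) _ → ∖-⊆ e y∈ , λ { refl → ∖-∉ e W y∈ } }
      where
      module R = IsRouting routing
      f∈F : f ∈ F
      f∈F = arc-from a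
      f≢e : f ≢ e
      f≢e refl = e∉V (F⊆V f∈F)
      f∉W : f ∉ W ∖ e
      -- A path starting in `f` would meet `p` in `f`, yet differ from `p`, which starts in `e`.
      f∉W f∈W with R.starts (∖-⊆ e f∈W)
      ... | q , q∈R , refl = R.disjoint p∈R q∈R (λ { refl → f≢e refl })
                               (there (here refl) , here refl)

  -- Deflates and gammoids.

  -- Sets without `e` are routed alike in both digraphs. In a set with `e`, `principal` exchanges
  -- `e` for some `f` in `F`, which matches the first arc of the path from `e`.
  extend-gammoid : ∀ M {Y e} → e ∈ ground (system M) → e ∉ Y →
                   HasUniqueMinimal (λ F → IsFlat (system M ∣ Y) F × cl (system M) F e) →
                   IsGammoidSystem (system M ∣ Y) → IsGammoidSystem (system M ∣ (Y ++ [ e ]))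
  extend-gammoid M {Y} {e} e∈E e∉Y hum gammoid
    with SingleExtension.principal M e∈E e∉Y hum | avoid-vertex {system M ∣ Y} e e∉Y gammoid
  ... | F , F⊆Y , principal | D , T , E , T⊆V , E⊆V , e∉V , Y∼E , Y⇒ , ⇒Y =
    addSource , T , e ∷ E , there ∘ T⊆V , ∷-⊆ (here refl) (there ∘ E⊆V)
    , mk⇔ Ye⊆eE eE⊆Ye , to , from
    where
    open Matroid M using (hereditary)
    S = system M
    Y⊆E′ : Y ⊆ E
    Y⊆E′ = Equivalence.to Y∼E
    open AddSource D e∉V {F} (E⊆V ∘ Y⊆E′ ∘ F⊆Y)

    Ye⊆eE : Y ++ [ e ] ⊆ e ∷ E
    Ye⊆eE x∈ with ∈-++⁻ Y x∈
    ... | inj₁ x∈Y         = there (Y⊆E′ x∈Y)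
    ... | inj₂ (here refl) = here refl

    eE⊆Ye : e ∷ E ⊆ Y ++ [ e ]
    eE⊆Ye = ∷-⊆ (∈-++⁺ʳ Y (here refl)) (∈-++⁺ˡ ∘ Equivalence.from Y∼E)

    in-Y : ∀ {W x} → W ⊆ e ∷ E → x ∈ W → x ≢ e → x ∈ Y
    in-Y W⊆ x∈W x≢e with W⊆ x∈W
    ... | here x≡e  = contradiction x≡e x≢e
    ... | there x∈E = Equivalence.from Y∼E x∈E

    W∖e⊆Y : ∀ {W} → W ⊆ e ∷ E → W ∖ e ⊆ Y
    W∖e⊆Y {W} W⊆ x∈ = in-Y W⊆ (∖-⊆ e x∈) λ { refl → ∖-∉ e W x∈ }

    to : ∀ {W} → Indep (S ∣ (Y ++ [ e ])) W → Indep (Γ addSource T (e ∷ E)) W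
    to {W} (W⊆ , iW) with e ∈? W
    ... | no e∉W =
      let _ , R , routing = Y⇒ ((λ x∈W → in-Y (Ye⊆eE ∘ W⊆) x∈W λ { refl → e∉W x∈W }) , iW)
      in Ye⊆eE ∘ W⊆ , R , lift-routing routing
    ... | yes e∈W =
      let Z⊆Y = W∖e⊆Y (Ye⊆eE ∘ W⊆)
          f , f∈F , f∉Z , ifZ = Equivalence.to (principal Z⊆Y)
                                  (hereditary (∷-⊆ e∈W (∖-⊆ e)) iW)
          _ , R , routing = Y⇒ (∷-⊆ (F⊆Y f∈F) Z⊆Y , ifZ)
      in Ye⊆eE ∘ W⊆ , route-source f∈F f∉Z routing

    from : ∀ {W} → Indep (Γ addSource T (e ∷ E)) W → Indep (S ∣ (Y ++ [ e ])) W
    from {W} (W⊆ , R , routing) with e ∈? W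
    ... | no e∉W =
      let W⊆Y = λ {x} (x∈W : x ∈ W) → in-Y W⊆ x∈W λ { refl → e∉W x∈W }
      in eE⊆Ye ∘ W⊆ , proj₂ (⇒Y (Y⊆E′ ∘ W⊆Y , _ , drop-routing e∉W routing))
    ... | yes e∈W =
      let Z⊆Y = W∖e⊆Y W⊆
          f , f∈F , f∉Z , routed = unroute-source T⊆V e∈W routing
          _ , ifZ = ⇒Y (Y⊆E′ ∘ ∷-⊆ (F⊆Y f∈F) Z⊆Y , routed)
      in eE⊆Ye ∘ W⊆ , hereditary (⊆-∷∖ e W)
           (Equivalence.from (principal Z⊆Y) (f , f∈F , f∉Z , ifZ))

  extend-gammoid* : ∀ M {X} es → es ⊆ ground (system M) →
                    (∀ {x} → x ∈ es → x ∉ X) → Unique es →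
                    (∀ (i : Fin (length es)) → HasUniqueMinimal λ F →
                       IsFlat (system M ∣ (X ++ take (toℕ i) es)) F × cl (system M) F (lookup es i)) →
                    IsGammoidSystem (system M ∣ X) → IsGammoidSystem (system M ∣ (X ++ es))
  extend-gammoid* M {X} [] _ _ _ _ gammoid =
    subst (λ Y → IsGammoidSystem (system M ∣ Y)) (sym (++-identityʳ X)) gammoid
  extend-gammoid* M {X} (e ∷ es) es⊆E es∉X (e∉es ∷ es!) hum gammoid =
    subst (λ Y → IsGammoidSystem (system M ∣ Y)) (++-assoc X [ e ] es)
      (extend-gammoid* M es
        (es⊆E ∘ there)
        (λ x∈es → [ es∉X (there x∈es)
                  , (λ { (here refl) → All.lookup e∉es x∈es refl ; (there ()) }) ]′ ∘ ∈-++⁻ X)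
        es!
        -- Moving `e` into the restriction shifts indices by one: the condition at `suc i` becomes
        -- the condition at `i`, up to reassociating the lists.
        (λ i → subst (λ Y → HasUniqueMinimal λ F → IsFlat (system M ∣ Y) F × cl (system M) F (lookup es i))
                 (sym (++-assoc X [ e ] (take (toℕ i) es))) (hum (suc i)))
        (extend-gammoid M (es⊆E (here refl)) (es∉X (here refl))
          (subst (λ Y → HasUniqueMinimal λ F → IsFlat (system M ∣ Y) F × cl (system M) F e)
            (++-identityʳ X) (hum zero))
          gammoid))

  deflate-gammoid : ∀ {N M} → IsDeflateOf N M → IsGammoid N ⇔ IsGammoid M
  deflate-gammoid {N} {M} (X , X⊆E , (N∼X , N⇒ , ⇒N) , es , es! , es⇔ , hum) = mk⇔
    -- `es` lists the ground set outside `X`, so `M` equals its restriction to `X ++ es`.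
    (λ gN → ≈ₛ-restrict-gammoid {system M ∣ (X ++ es)} {system M} {X ++ es} id
      ( mk⇔ E⊆ ⊆E
      , (λ i → E⊆ ∘ Matroid.⊆-ground M i , E⊆ ∘ Matroid.⊆-ground M i , i)
      , proj₂ ∘ proj₂)
      (extend-gammoid* M es (proj₁ ∘ Equivalence.to (es⇔ _))
        (proj₂ ∘ Equivalence.to (es⇔ _)) es! hum
        (≈ₛ-restrict-gammoid {system N} {system M ∣ X} {X} (Equivalence.from N∼X)
          (mk⇔ id id , (λ i → proj₁ i , ⇒N i) , N⇒ ∘ proj₂) gN)))
    (≈ₛ-restrict-gammoid {system M} {system N} X⊆E (N∼X , N⇒ , ⇒N))
    where
    ⊆E : X ++ es ⊆ ground (system M)
    ⊆E = [ X⊆E , proj₁ ∘ Equivalence.to (es⇔ _) ]′ ∘ ∈-++⁻ X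

    E⊆ : ground (system M) ⊆ X ++ es
    E⊆ {x} x∈E with x ∈? X
    ... | yes x∈X = ∈-++⁺ˡ x∈X
    ... | no  x∉X = ∈-++⁺ʳ X (Equivalence.from (es⇔ x) (x∈E , x∉X))

  -- Validity of the identified tableau.

  SameGammoid : ∀ T → MemberOf T → MemberOf T → Set
  SameGammoid T M N = IsGammoid (proj₁ M) ⇔ IsGammoid (proj₁ N)

  valid-≃ : ∀ {T} → IsValid T → ∀ {M N} → Tableau._≃_ T M N → SameGammoid T M N
  valid-≃ {T} valid {M} {N} M≃N with IsValid.classes valid M
  ... | inj₁ all  = mk⇔ (λ _ → all N M≃N) λ _ → all M (IsEquivalence.refl (Tableau.≃-isEquivalence T))
  ... | inj₂ none = mk⇔
        (λ g → contradiction g (none M (IsEquivalence.refl (Tableau.≃-isEquivalence T))))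
        λ g → contradiction g (none N M≃N)

  identify-valid : ∀ T → IsValid T → ∀ M₁ M₂ → SameGammoid T M₁ M₂ → IsValid (identify T M₁ M₂)
  identify-valid T valid M₁ M₂ same = record
    { 𝓖-gammoids    = 𝓖-gammoids
    ; 𝓜-not-strict  = 𝓜-not-strict
    ; 𝓧-no-gammoids = 𝓧-no-gammoids
    -- The old alternative, read at `M` itself by reflexivity, says whether `M` is a gammoid; this
    -- passes to the whole new class.
    ; classes       = λ M → Sum.map
        (λ all N M≃′N → Equivalence.to (≃′-same M≃′N) (all M (IsEquivalence.refl ≃-isEquivalence)))
        (λ none N M≃′N → none M (IsEquivalence.refl ≃-isEquivalence) ∘ Equivalence.from (≃′-same M≃′N))
        (classes M)
    }
    where
    open Tableau T using (≃-isEquivalence)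
    open IsValid valid

    step : ∀ {M N} → Identified T M₁ M₂ M N → SameGammoid T M N
    step (old M≃N) = valid-≃ valid M≃N
    step new       = same

    -- `⇔` is an equivalence, so what holds along generating pairs holds for the closure.
    ≃′-same : ∀ {M N} → EqClosure.EqClosure (Identified T M₁ M₂) M N → SameGammoid T M N
    ≃′-same = EqClosure.gfold ⇔-isEquivalence (IsGammoid ∘ proj₁) step

lemma3p12 : (𝕌 : Universe) → let open Matroids 𝕌 in
    (T : Tableau) → IsValid T →
    (M₁ M₂ : MemberOf T) → IsDeflateOf (proj₁ M₁) (proj₁ M₂) →
    IsValid (identify T M₁ M₂)
lemma3p12 𝕌 T valid M₁ M₂ deflate =
  identify-valid 𝕌 T valid M₁ M₂ (deflate-gammoid 𝕌 {proj₁ M₁} {proj₁ M₂} deflate)
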